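{- There is no almost linear minimal field.
   Context: An infinite first-order structure $M$ is minimal if every subset of $M$ definable in $M$ with parameters is finite or co-finite. A minimal field is a minimal structure which is a field, possibly with additional first-order structure. The generic type of a minimal structure $M$ is the unique non-algebraic type $p\in S_1(M)$; let $\bar M\succ M$ be a monster model and $p(\bar M)$ the set of realizations of $p$ in $\bar M$. For a strict partial order $<$, incomparability is the relation $x\sim y$ iff $\neg(x<y\vee y<x)$. A strict partial order $<$ on $M$, definable with parameters and having infinite chains, is almost linear if $\sim$ is an equivalence relation on $p(\bar M)$. The structure $M$ is almost linear if such an order exists. -}

module Defs where

open import Level using (Level; suc)
open import Algebra.Structures using (IsCommutativeRing)
open import Data.Empty.Polymorphic using (⊥)
open import Data.Fin.Base using (Fin)
open import Data.List.Base using (List)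
open import Data.List.Membership.Propositional using () renaming (_∈_ to _∈ˡ_; _∉_ to _∉ˡ_)
open import Data.List.Relation.Unary.All using (All)
open import Data.Nat.Base as ℕ using (ℕ)
open import Data.Product.Base using (Σ; ∃; _×_; _,_; proj₁)
open import Data.Sum.Base using (_⊎_; inj₁; inj₂)
open import Data.Vec.Base using (Vec; []; _∷_; _++_; lookup; map)
open import Function.Base using (id; _on_)
open import Function.Bundles using (_⇔_; _↣_)
open import Function.Definitions using (Bijective)
open import Relation.Binary.Core using (Rel)
open import Relation.Binary.PropositionalEquality.Core using (_≡_; _≢_)
open import Relation.Binary.Structures using (IsEquivalence; IsStrictPartialOrder)
open import Relation.Nullary.Negation using (¬_; contradiction)
open import Relation.Unary using (Pred; _∈_; ∁)

private
  variable
    ℓ : Level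

-- Infinite is the positive form of "not finite"; classically it is the
-- negation of Finite.

Finite : {A : Set ℓ} → Pred A ℓ → Set ℓ
Finite P = ∃ λ xs → ∀ x → P x → x ∈ˡ xs

Cofinite : {A : Set ℓ} → Pred A ℓ → Set ℓ
Cofinite P = Finite (∁ P)

Infinite : {A : Set ℓ} → Pred A ℓ → Set ℓ
Infinite {A = A} P = (xs : List A) → ∃ λ x → P x × x ∉ˡ xs

InfiniteSet : Set ℓ → Set ℓ
InfiniteSet A = (xs : List A) → ∃ λ (x : A) → x ∉ˡ xs

record Language (ℓ : Level) : Set (suc ℓ) where
  field
    Func : ℕ → Set ℓ
    Rela : ℕ → Set ℓ

open Language public

data Term (L : Language ℓ) (n : ℕ) : Set ℓ where
  var  : Fin n → Term L n
  func : ∀ {k} → Func L k → Vec (Term L n) k → Term L n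

infixr 5 _⇒_
infix  6 _≐_

-- The free variables of a formula are the elements of Fin n; all′ binds
-- variable zero.  The remaining connectives and ∃ are the usual classical
-- abbreviations.

data Formula (L : Language ℓ) : ℕ → Set ℓ where
  ⊥′   : ∀ {n} → Formula L n
  _≐_  : ∀ {n} → Term L n → Term L n → Formula L n
  rela : ∀ {n k} → Rela L k → Vec (Term L n) k → Formula L n
  _⇒_  : ∀ {n} → Formula L n → Formula L n → Formula L n
  all′ : ∀ {n} → Formula L (ℕ.suc n) → Formula L n

record Structure (L : Language ℓ) : Set (suc ℓ) where
  field
    Carrier : Set ℓ
    ⟦_⟧ᶠ    : ∀ {k} → Func L k → Vec Carrier k → Carrier
    ⟦_⟧ʳ    : ∀ {k} → Rela L k → Vec Carrier k → Set ℓ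

∣_∣ : {L : Language ℓ} → Structure L → Set ℓ
∣ M ∣ = Structure.Carrier M

module _ {L : Language ℓ} (M : Structure L) where
  open Structure M

  mutual
    eval : ∀ {n} → Vec Carrier n → Term L n → Carrier
    eval v (var i)     = lookup v i
    eval v (func f ts) = ⟦ f ⟧ᶠ (evals v ts)

    evals : ∀ {n k} → Vec Carrier n → Vec (Term L n) k → Vec Carrier k
    evals v []       = []
    evals v (t ∷ ts) = eval v t ∷ evals v ts

  infix 4 _⊨_

  _⊨_ : ∀ {n} → Vec Carrier n → Formula L n → Set ℓ
  v ⊨ ⊥′        = ⊥
  v ⊨ (s ≐ t)   = eval v s ≡ eval v t
  v ⊨ rela R ts = ⟦ R ⟧ʳ (evals v ts)
  v ⊨ (φ ⇒ ψ)   = v ⊨ φ → v ⊨ ψ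
  v ⊨ all′ φ    = ∀ x → x ∷ v ⊨ φ

-- L(A)-formulas in n variables: the variables after the first n are
-- replaced by parameters from A.

record ParamFormula (L : Language ℓ) (A : Set ℓ) (n : ℕ) : Set ℓ where
  constructor _[_]
  field
    {arity} : ℕ
    formula : Formula L (n ℕ.+ arity)
    params  : Vec A arity

neg : {L : Language ℓ} {A : Set ℓ} {n : ℕ} → ParamFormula L A n → ParamFormula L A n
neg (φ [ a ]) = (φ ⇒ ⊥′) [ a ]

-- The map c interprets the parameters in N.
Sat : {L : Language ℓ} {A : Set ℓ} (N : Structure L) → (A → ∣ N ∣) →
      ∀ {n} → ParamFormula L A n → Pred (Vec ∣ N ∣ n) ℓ
Sat N c (φ [ a ]) v = _⊨_ N (v ++ map c a) φ

Solutions : {L : Language ℓ} (M : Structure L) → ParamFormula L ∣ M ∣ 1 → Pred ∣ M ∣ ℓ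
Solutions M φ x = Sat M id φ (x ∷ [])

FormulaSet : (L : Language ℓ) (A : Set ℓ) (n : ℕ) → Set (suc ℓ)
FormulaSet {ℓ} L A n = Pred (ParamFormula L A n) ℓ

module _ {L : Language ℓ} {A : Set ℓ} (N : Structure L) (c : A → ∣ N ∣) {n : ℕ} where

  Realizes : FormulaSet L A n → Pred (Vec ∣ N ∣ n) ℓ
  Realizes Γ v = ∀ φ → φ ∈ Γ → Sat N c φ v

  -- Finite satisfiability, with the classical (¬ ∀ ¬) reading of the
  -- existential quantifier over tuples.
  Consistent : FormulaSet L A n → Set ℓ
  Consistent Γ = ∀ Δ → All Γ Δ → ¬ (∀ v → ¬ All (λ φ → Sat N c φ v) Δ)

-- A non-algebraic complete 1-type over M; see generic-unique.
record GenericType {L : Language ℓ} (M : Structure L) : Set (suc ℓ) where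
  field
    type         : FormulaSet L ∣ M ∣ 1
    consistent   : Consistent M id type
    complete     : ∀ φ → φ ∈ type ⊎ neg φ ∈ type
    nonAlgebraic : ∀ φ → φ ∈ type → ¬ Finite (Solutions M φ)

record IsMinimal {L : Language ℓ} (M : Structure L) : Set ℓ where
  field
    infinite : InfiniteSet ∣ M ∣
    minimal  : ∀ φ → Finite (Solutions M φ) ⊎ Cofinite (Solutions M φ)

generic-unique : {L : Language ℓ} {M : Structure L} → IsMinimal M →
                 (p q : GenericType M) →
                 ∀ φ → φ ∈ GenericType.type p → φ ∈ GenericType.type q
generic-unique min p q φ φ∈p with GenericType.complete q φ
... | inj₁ φ∈q  = φ∈q
... | inj₂ ¬φ∈q with IsMinimal.minimal min φ
...   | inj₁ fin        = contradiction fin (GenericType.nonAlgebraic p φ φ∈p)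
...   | inj₂ (xs , cof) = contradiction
  (xs , λ x ¬φx → cof x λ φx → contradiction (¬φx φx) λ ())
  (GenericType.nonAlgebraic q (neg φ) ¬φ∈q)

-- The ring operations are named by symbols of L, which is otherwise
-- arbitrary.
record RingSymbols (L : Language ℓ) : Set ℓ where
  field
    zeroˢ oneˢ : Func L 0
    negˢ       : Func L 1
    addˢ mulˢ  : Func L 2

module RingOperations {L : Language ℓ} (M : Structure L) (S : RingSymbols L) where
  open Structure M
  open RingSymbols S

  infixl 6 _+_
  infixl 7 _*_
  infix  8 -_

  0# 1# : Carrier
  0# = ⟦ zeroˢ ⟧ᶠ []
  1# = ⟦ oneˢ ⟧ᶠ []

  -_ : Carrier → Carrier
  - x = ⟦ negˢ ⟧ᶠ (x ∷ [])

  _+_ _*_ : Carrier → Carrier → Carrier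
  x + y = ⟦ addˢ ⟧ᶠ (x ∷ y ∷ [])
  x * y = ⟦ mulˢ ⟧ᶠ (x ∷ y ∷ [])

record IsField {L : Language ℓ} (M : Structure L) : Set ℓ where
  field
    symbols : RingSymbols L
  open RingOperations M symbols public
  field
    isCommutativeRing : IsCommutativeRing _≡_ _+_ _*_ -_ 0# 1#
    1≢0               : 1# ≢ 0#
    inverse           : ∀ x → x ≢ 0# → ∃ λ y → x * y ≡ 1#

record IsMinimalField {L : Language ℓ} (M : Structure L) : Set ℓ where
  field
    isMinimal : IsMinimal M
    isField   : IsField M

record Automorphism {L : Language ℓ} (N : Structure L) : Set ℓ where
  open Structure N
  field
    to        : Carrier → Carrier
    bijective : Bijective _≡_ _≡_ to
    pres-func : ∀ {k} (f : Func L k) v → to (⟦ f ⟧ᶠ v) ≡ ⟦ f ⟧ᶠ (map to v)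
    pres-rela : ∀ {k} (R : Rela L k) v → ⟦ R ⟧ʳ v ⇔ ⟦ R ⟧ʳ (map to v)

-- An elementary extension of M that is κ-saturated and strongly
-- κ-homogeneous, where κ is the successor of the cardinality of Index and
-- κ > |M| + |L|.  A set of parameters of size less than κ is given as a
-- family indexed by a type that embeds in Index.

record MonsterModel {L : Language ℓ} (M : Structure L) : Set (suc ℓ) where
  field
    model       : Structure L
    embed       : ∣ M ∣ → ∣ model ∣
    elementary  : ∀ {n} (φ : Formula L n) (v : Vec ∣ M ∣ n) →
                  _⊨_ M v φ ⇔ _⊨_ model (map embed v) φ
    Index       : Set ℓ
    M-small     : ∣ M ∣ ↣ Index
    L-small     : ∃ (Formula L) ↣ Index
    saturated   : {A : Set ℓ} → A ↣ Index → (c : A → ∣ model ∣) →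
                  ∀ {n} (Γ : FormulaSet L A n) →
                  Consistent model c Γ → ∃ (Realizes model c Γ)
    homogeneous : {A : Set ℓ} → A ↣ Index → (c d : A → ∣ model ∣) →
                  (∀ {n} (φ : Formula L n) (a : Vec A n) →
                    _⊨_ model (map c a) φ ⇔ _⊨_ model (map d a) φ) →
                  Σ (Automorphism model) λ σ → ∀ i → Automorphism.to σ (c i) ≡ d i

Incomparable : {A : Set ℓ} → Rel A ℓ → Rel A ℓ
Incomparable _<_ x y = ¬ (x < y ⊎ y < x)

IsChain : {A : Set ℓ} → Rel A ℓ → Pred A ℓ → Set ℓ
IsChain _<_ C = ∀ x y → C x → C y → x ≡ y ⊎ (x < y ⊎ y < x)

DefinedRel : {L : Language ℓ} {A : Set ℓ} (N : Structure L) → (A → ∣ N ∣) →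
             ParamFormula L A 2 → Rel ∣ N ∣ ℓ
DefinedRel N c φ x y = Sat N c φ (x ∷ y ∷ [])

module _ {L : Language ℓ} (M : Structure L) (p : GenericType M) (M̄ : MonsterModel M) where
  open GenericType p using (type)
  open MonsterModel M̄ using (model; embed)

  Realization : Set ℓ
  Realization = ∃ λ (a : ∣ model ∣) → Realizes model embed type (a ∷ [])

  record IsAlmostLinearOrder (φ : ParamFormula L ∣ M ∣ 2) : Set (suc ℓ) where
    field
      isStrictPartialOrder : IsStrictPartialOrder _≡_ (DefinedRel M id φ)
      infiniteChain        : ∃ λ (C : Pred ∣ M ∣ ℓ) → IsChain (DefinedRel M id φ) C × Infinite C
      ∼-isEquivalence      : IsEquivalence {A = Realization}
                               (Incomparable (DefinedRel model embed φ) on proj₁)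

  AlmostLinear : Set (suc ℓ)
  AlmostLinear = ∃ IsAlmostLinearOrder

{-# OPTIONS --safe #-}

-- By compactness, incomparability is transitive off a finite subset of M, and
-- sending that subset to the bottom turns < into a definable weak order with
-- finite classes.  A definable involution σ satisfies σ x ∼ x for almost all
-- x, since x < σ x for almost all x would give σ x < σ (σ x) = x as well.
-- Translations and homotheties are products of two involutions, so each of
-- them preserves almost all classes, and the stabilisers of the classes under
-- translations form a definable family of finite subgroups.  With its help the
-- family is made into a definable chain V of finite subgroups such that every
-- element lies in almost all V t, and every homothety preserves almost all V t.
--
-- Now ask whether x = y² + y has a solution y lying in every V t that contains
-- x.  If this holds for almost all x, then y ↦ y² + y maps a large V t onto
-- almost all of itself, although it identifies y with −1 − y.  If it fails for
-- almost all x, then a generic y lies outside some V t containing y² + y, and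
-- c y outside some V t′ containing (c y)² + c y; by the chain condition one of
-- V t and V t′ contains both values, hence their combination (c − c²) y.

module Submission where

open import Defs
open import Level using (Level)
open import Algebra.Bundles using (CommutativeRing)
open import Data.Empty using (⊥; ⊥-elim)
import Data.Empty.Polymorphic as Poly
open import Data.Fin.Base using (Fin; zero; suc; splitAt; _↑ˡ_; _↑ʳ_)
open import Data.Fin.Patterns using (0F; 1F; 2F)
open import Data.List.Base using (List; []; _∷_; length; map; _++_)
open import Data.List.Membership.Propositional using (_∈_; _∉_)
open import Data.List.Membership.Propositional.Properties
  using (∈-++⁺ˡ; ∈-++⁺ʳ; ∈-++⁻; ∈-map⁺; ∈-∃++)
open import Data.List.Properties using (length-++)
open import Data.List.Relation.Unary.All as All using (All; []; _∷_)
open import Data.List.Relation.Unary.AllPairs using ([]; _∷_)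
open import Data.List.Relation.Unary.Any using (here; there)
open import Data.List.Relation.Unary.Unique.Propositional using (Unique)
open import Data.Nat.Base as ℕ using (ℕ; _≤_; z≤n; s≤s)
import Data.Nat.Properties as ℕ
open import Data.Product.Base using (∃; _×_; _,_; proj₁; proj₂)
open import Data.Sum.Base using (_⊎_; inj₁; inj₂; [_,_]′)
open import Data.Vec.Base as Vec using (Vec; []; _∷_; lookup)
open import Data.Vec.Properties using (lookup-++ˡ; lookup-++ʳ; lookup-splitAt; map-++; map-id)
open import Function.Base using (id; _∘_; _$_)
open import Function.Bundles using (_⇔_; mk⇔; Equivalence)
open import Function.Related.TypeIsomorphisms using (→-cong-⇔)
open import Relation.Binary.PropositionalEquality hiding ([_])
open import Relation.Binary.Structures using (IsEquivalence; IsStrictPartialOrder)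
open import Relation.Nullary.Decidable using (yes; no; ¬¬-excluded-middle; decidable-stable)
open import Relation.Nullary.Negation using (¬_; contradiction; ¬¬-map; Stable; negated-stable)

open Equivalence using (to; from)

private
  variable
    a b ℓ : Level
    A B : Set a
    P Q : A → Set ℓ
    k m n : ℕ

-- The cofinite quantifier.

Most : {A : Set a} → (A → Set b) → Set _
Most {A = A} P = ¬ ¬ ∃ λ (xs : List A) → ∀ x → x ∉ xs → P x

most-always : (∀ x → P x) → Most P
most-always p k = k ([] , λ x _ → p x)

most-map : (∀ x → P x → Q x) → Most P → Most Q
most-map f = ¬¬-map λ (xs , p) → xs , λ x x∉ → f x (p x x∉)

most-× : Most P → Most Q → Most (λ x → P x × Q x)
most-× mp mq k = mp λ (xs , p) → mq λ (ys , q) →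
  k (xs ++ ys , λ x x∉ → p x (x∉ ∘ ∈-++⁺ˡ) , q x (x∉ ∘ ∈-++⁺ʳ xs))

-- `Most` is a negation, so its proofs may decide cases by excluded middle and open other `Most`
-- hypotheses.
most-join : ¬ ¬ Most P → Most P
most-join mmp k = mmp λ mp → mp k

most-∘ : {P : A → Set ℓ} (f g : A → A) → (∀ x → g (f x) ≡ x) → Most P → Most (P ∘ f)
most-∘ f g gf = ¬¬-map λ (xs , p) → map g xs , λ x x∉ →
  p (f x) λ fx∈ → x∉ (subst (_∈ map g xs) (gf x) (∈-map⁺ g fx∈))

most-∀∈ : {P : A → B → Set ℓ} → (∀ y → Most (λ x → P x y)) →
          ∀ ys → Most (λ x → ∀ y → y ∈ ys → P x y)
most-∀∈ mp []       = most-always λ x y ()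
most-∀∈ mp (y ∷ ys) =
  most-map (λ { x (p , ps) _ (here refl) → p ; x (p , ps) z (there z∈) → ps z z∈ })
           (most-× (mp y) (most-∀∈ mp ys))

most-∉ : (xs : List A) → Most (_∉ xs)
most-∉ xs k = k (xs , λ x x∉ → x∉)

most-≢ : (y : A) → Most (_≢ y)
most-≢ y k = k (y ∷ [] , λ x x∉ x≡y → x∉ (here x≡y))

most-∃ : InfiniteSet A → {P : A → Set b} → Most P → ¬ ¬ ∃ P
most-∃ inf = ¬¬-map λ (xs , p) → let (x , x∉) = inf xs in x , p x x∉

-- Renaming of variables.

module _ {L : Language ℓ} where

  mutual
    renameᵗ : (Fin m → Fin n) → Term L m → Term L n
    renameᵗ ρ (var i)     = var (ρ i)
    renameᵗ ρ (func f ts) = func f (renameᵗˢ ρ ts)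

    renameᵗˢ : ∀ {k} → (Fin m → Fin n) → Vec (Term L m) k → Vec (Term L n) k
    renameᵗˢ ρ []       = []
    renameᵗˢ ρ (t ∷ ts) = renameᵗ ρ t ∷ renameᵗˢ ρ ts

  lift : (Fin m → Fin n) → Fin (ℕ.suc m) → Fin (ℕ.suc n)
  lift ρ zero    = zero
  lift ρ (suc i) = suc (ρ i)

  rename : (Fin m → Fin n) → Formula L m → Formula L n
  rename ρ ⊥′          = ⊥′
  rename ρ (s ≐ t)     = renameᵗ ρ s ≐ renameᵗ ρ t
  rename ρ (rela R ts) = rela R (renameᵗˢ ρ ts)
  rename ρ (φ ⇒ ψ)     = rename ρ φ ⇒ rename ρ ψ
  rename ρ (all′ φ)    = all′ (rename (lift ρ) φ)

  module _ (M : Structure L) where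
    open Structure M

    Agrees : (Fin m → Fin n) → Vec Carrier m → Vec Carrier n → Set ℓ
    Agrees ρ v w = ∀ i → lookup w (ρ i) ≡ lookup v i

    mutual
      eval-rename : ∀ {ρ : Fin m → Fin n} {v w} → Agrees ρ v w →
                    ∀ t → eval M w (renameᵗ ρ t) ≡ eval M v t
      eval-rename ag (var i)     = ag i
      eval-rename ag (func f ts) = cong ⟦ f ⟧ᶠ (evals-rename ag ts)

      evals-rename : ∀ {ρ : Fin m → Fin n} {v w} → Agrees ρ v w →
                     ∀ {k} (ts : Vec _ k) → evals M w (renameᵗˢ ρ ts) ≡ evals M v ts
      evals-rename ag []       = refl
      evals-rename ag (t ∷ ts) = cong₂ _∷_ (eval-rename ag t) (evals-rename ag ts)

    agrees-lift : ∀ {ρ : Fin m → Fin n} {v w} → Agrees ρ v w →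
                  ∀ x → Agrees (lift ρ) (x ∷ v) (x ∷ w)
    agrees-lift ag x zero    = refl
    agrees-lift ag x (suc i) = ag i

    ∀-cong-⇔ : {P Q : Carrier → Set ℓ} → (∀ x → P x ⇔ Q x) → (∀ x → P x) ⇔ (∀ x → Q x)
    ∀-cong-⇔ e = mk⇔ (λ p x → to (e x) (p x)) (λ q x → from (e x) (q x))

    ≡⇒⇔ : {P Q : Set ℓ} → P ≡ Q → P ⇔ Q
    ≡⇒⇔ refl = mk⇔ id id

    ⊨-rename : ∀ {ρ : Fin m → Fin n} {v w} → Agrees ρ v w →
               ∀ φ → _⊨_ M v φ ⇔ _⊨_ M w (rename ρ φ)
    ⊨-rename ag ⊥′          = mk⇔ id id
    ⊨-rename ag (s ≐ t)     = ≡⇒⇔ (sym (cong₂ _≡_ (eval-rename ag s) (eval-rename ag t)))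
    ⊨-rename ag (rela R ts) = ≡⇒⇔ (sym (cong ⟦ R ⟧ʳ (evals-rename ag ts)))
    ⊨-rename ag (φ ⇒ ψ)     = →-cong-⇔ (⊨-rename ag φ) (⊨-rename ag ψ)
    ⊨-rename ag (all′ φ)    = ∀-cong-⇔ λ x → ⊨-rename (agrees-lift ag x) φ

-- Definable relations and minimality.

-- L-equations and one additional relation symbol ≺, read negatively, so that
-- every formula is stable under double negation.

infix  7 _≈_ _≺_
infixr 6 _∧_
infixr 5 _⊃_

data NFormula (L : Language ℓ) : ℕ → Set ℓ where
  _≈_ _≺_ : Term L n → Term L n → NFormula L n
  not     : NFormula L n → NFormula L n
  _∧_ _⊃_ : NFormula L n → NFormula L n → NFormula L n
  forall′ : NFormula L (ℕ.suc n) → NFormula L n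

module NSemantics {L : Language ℓ} (M : Structure L) (φ : ParamFormula L ∣ M ∣ 2) where
  open Structure M
  open ParamFormula φ

  infix 4 _<_
  _<_ : Carrier → Carrier → Set ℓ
  x < y = ¬ ¬ DefinedRel M id φ x y

  ⟦_⟧ : NFormula L n → Vec Carrier n → Set ℓ
  ⟦ s ≈ t ⟧     v = ¬ ¬ eval M v s ≡ eval M v t
  ⟦ s ≺ t ⟧     v = eval M v s < eval M v t
  ⟦ not θ ⟧     v = ¬ ⟦ θ ⟧ v
  ⟦ θ ∧ η ⟧     v = ⟦ θ ⟧ v × ⟦ η ⟧ v
  ⟦ θ ⊃ η ⟧     v = ⟦ θ ⟧ v → ⟦ η ⟧ v
  ⟦ forall′ θ ⟧ v = ∀ x → ⟦ θ ⟧ (x ∷ v)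

  stable : (θ : NFormula L n) → ∀ v → Stable (⟦ θ ⟧ v)
  stable (s ≈ t)     v = negated-stable
  stable (s ≺ t)     v = negated-stable
  stable (not θ)     v = negated-stable
  stable (θ ∧ η)     v k = stable θ v (¬¬-map proj₁ k) , stable η v (¬¬-map proj₂ k)
  stable (θ ⊃ η)     v k p = stable η v (¬¬-map (_$ p) k)
  stable (forall′ θ) v k x = stable θ (x ∷ v) (¬¬-map (_$ x) k)

  private
    ps : Vec Carrier arity
    ps = Vec.map id params

    neg′ : Formula L n → Formula L n
    neg′ ψ = ψ ⇒ ⊥′

    inj : Fin n → Fin (n ℕ.+ arity)
    inj = _↑ˡ arity

    -- Keeps the two quantified term values and moves the parameters past the `n` free variables of
    -- the surrounding formula.
    relVars : ∀ n → Fin (2 ℕ.+ arity) → Fin (2 ℕ.+ (n ℕ.+ arity))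
    relVars n zero          = zero
    relVars n (suc zero)    = suc zero
    relVars n (suc (suc i)) = suc (suc (n ↑ʳ i))

    shift² : Fin n → Fin (2 ℕ.+ (n ℕ.+ arity))
    shift² i = suc (suc (inj i))

  -- Terms are substituted into the defining formula of the relation by
  -- quantifying over their values.
  translate : NFormula L n → Formula L (n ℕ.+ arity)
  translate (s ≈ t) = neg′ (neg′ (renameᵗ inj s ≐ renameᵗ inj t))
  translate {n = n} (s ≺ t) =
    all′ (all′ (var zero ≐ renameᵗ shift² s ⇒ var (suc zero) ≐ renameᵗ shift² t ⇒
      neg′ (neg′ (rename (relVars n) formula))))
  translate (not θ)     = neg′ (translate θ)
  translate (θ ∧ η)     = neg′ (translate θ ⇒ neg′ (translate η))
  translate (θ ⊃ η)     = translate θ ⇒ translate η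
  translate (forall′ θ) = all′ (translate θ)

  private
    neg⇔ : {X Y : Set ℓ} → X ⇔ Y → (¬ X) ⇔ (Y → Poly.⊥ {ℓ})
    neg⇔ e = mk⇔ (λ ¬x y → contradiction (from e y) ¬x) (λ ¬y x → Poly.⊥-elim (¬y (to e x)))

    agrees-inj : (v : Vec Carrier n) → Agrees M inj v (v Vec.++ ps)
    agrees-inj v i = lookup-++ˡ v ps i

    agrees-rel : ∀ x y (v : Vec Carrier n) →
                 Agrees M (relVars n) (x ∷ y ∷ ps) (x ∷ y ∷ (v Vec.++ ps))
    agrees-rel x y v zero          = refl
    agrees-rel x y v (suc zero)    = refl
    agrees-rel x y v (suc (suc i)) = lookup-++ʳ v ps i

  ⊨-translate : (θ : NFormula L n) → ∀ v → ⟦ θ ⟧ v ⇔ _⊨_ M (v Vec.++ ps) (translate θ)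
  ⊨-translate (s ≈ t) v =
    neg⇔ (neg⇔ (≡⇒⇔ M (sym (cong₂ _≡_ (eval-rename M (agrees-inj v) s)
                                       (eval-rename M (agrees-inj v) t)))))
  ⊨-translate {n = n} (s ≺ t) v = mk⇔
    (λ s<t y x x≡s y≡t → to (atom x y)
      (subst₂ _<_ (sym (trans x≡s (value s))) (sym (trans y≡t (value t))) s<t))
    (λ h → from (atom _ _) (h _ _ (sym (value s)) (sym (value t))))
    where
    value : ∀ {x y : Carrier} t → eval M (x ∷ y ∷ (v Vec.++ ps)) (renameᵗ shift² t) ≡ eval M v t
    value = eval-rename M (λ i → lookup-++ˡ v ps i)

    atom : ∀ x y → x < y ⇔
           _⊨_ M (x ∷ y ∷ (v Vec.++ ps)) (neg′ (neg′ (rename (relVars n) formula)))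
    atom x y = neg⇔ (neg⇔ (⊨-rename M (agrees-rel x y v) formula))
  ⊨-translate (not θ)     v = neg⇔ (⊨-translate θ v)
  ⊨-translate (θ ∧ η)     v = mk⇔
    (λ (p , q) k → k (to (⊨-translate θ v) p) (to (⊨-translate η v) q))
    (λ k → stable (θ ∧ η) v λ ¬pq → Poly.⊥-elim (k λ p q →
      contradiction (from (⊨-translate θ v) p , from (⊨-translate η v) q) ¬pq))
  ⊨-translate (θ ⊃ η)     v = →-cong-⇔ (⊨-translate θ v) (⊨-translate η v)
  ⊨-translate (forall′ θ) v = ∀-cong-⇔ M λ x → ⊨-translate θ (x ∷ v)

  private
    map-id-++ : (v : Vec Carrier n) → Vec.map id (v Vec.++ params) ≡ v Vec.++ ps
    map-id-++ v = trans (map-++ id v params) (cong (Vec._++ ps) (map-id v))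

  -- Minimality applies to the translated formula, whose parameters are `v` and those of `φ`;
  -- stability removes the double negation left in the cofinite case.
  dichotomy : IsMinimal M → (θ : NFormula L (ℕ.suc n)) (v : Vec Carrier n) →
              (∃ λ xs → ∀ x → x ∉ xs → ¬ ⟦ θ ⟧ (x ∷ v)) ⊎
              (∃ λ xs → ∀ x → x ∉ xs → ⟦ θ ⟧ (x ∷ v))
  dichotomy min θ v with IsMinimal.minimal min (translate θ [ v Vec.++ params ])
  ... | inj₁ (xs , fin) = inj₁ (xs , λ x x∉ θx → x∉ (fin x
          (subst (λ ws → _⊨_ M (x ∷ ws) (translate θ)) (sym (map-id-++ v)) (to (⊨-translate θ (x ∷ v)) θx))))
  ... | inj₂ (xs , cof) = inj₂ (xs , λ x x∉ → stable θ (x ∷ v) λ ¬θx → x∉ (cof x λ h →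
          ¬θx (from (⊨-translate θ (x ∷ v)) (subst (λ ws → _⊨_ M (x ∷ ws) (translate θ)) (map-id-++ v) h))))

  -- Lets a relation defined from `≺` take the place of `≺`, so that the order can be reversed or
  -- modified repeatedly.
  definedRel : (θ : NFormula L (2 ℕ.+ n)) (v : Vec Carrier n) → ParamFormula L Carrier 2
  definedRel θ v = translate θ [ v Vec.++ params ]

  definedRel⇔ : (θ : NFormula L (2 ℕ.+ n)) (v : Vec Carrier n) → ∀ x y →
                ⟦ θ ⟧ (x ∷ y ∷ v) ⇔ (¬ ¬ DefinedRel M id (definedRel θ v) x y)
  definedRel⇔ θ v x y = mk⇔
    (λ p k → k (subst (λ ws → _⊨_ M (x ∷ y ∷ ws) (translate θ)) (sym (map-id-++ v)) (to (⊨-translate θ _) p)))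
    (λ h → stable θ _ (¬¬-map (λ p → from (⊨-translate θ _)
      (subst (λ ws → _⊨_ M (x ∷ y ∷ ws) (translate θ)) (map-id-++ v) p)) h))

-- Counting with duplicate-free lists.

unique-⊆-length : {xs ys : List A} → Unique xs → All (_∈ ys) xs → length xs ≤ length ys
unique-⊆-length []       []         = z≤n
unique-⊆-length {A = A} {xs = x ∷ xs} (x∉ ∷ u) (x∈ ∷ xs∈) with ∈-∃++ x∈
... | as , bs , refl = begin
  ℕ.suc (length xs)             ≤⟨ s≤s (unique-⊆-length u (All.zipWith (λ (p , q) → drop p q) (x∉ , xs∈))) ⟩
  ℕ.suc (length (as ++ bs))     ≡⟨ cong ℕ.suc (length-++ as) ⟩
  ℕ.suc (length as ℕ.+ length bs) ≡⟨ ℕ.+-suc (length as) (length bs) ⟨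
  length as ℕ.+ length (x ∷ bs) ≡⟨ length-++ as ⟨
  length (as ++ x ∷ bs)         ∎
  where
  open ℕ.≤-Reasoning
  drop : ∀ {y} → x ≢ y → y ∈ as ++ x ∷ bs → y ∈ as ++ bs
  drop x≢y y∈ with ∈-++⁻ as y∈
  ... | inj₁ y∈as         = ∈-++⁺ˡ y∈as
  ... | inj₂ (here y≡x)   = contradiction (sym y≡x) x≢y
  ... | inj₂ (there y∈bs) = ∈-++⁺ʳ as y∈bs

¬¬-all : {xs : List A} → (∀ {x} → x ∈ xs → ¬ ¬ P x) → ¬ ¬ All P xs
¬¬-all {xs = []}     p k = k []
¬¬-all {xs = x ∷ xs} p k = p (here refl) λ px → ¬¬-all (p ∘ there) λ pxs → k (px ∷ pxs)

unique-length-≤ : {xs ys : List A} → Unique xs → (∀ {x} → x ∈ xs → ¬ ¬ x ∈ ys) →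
                  length xs ≤ length ys
unique-length-≤ {xs = xs} {ys} u xs⊆ys =
  decidable-stable (length xs ℕ.≤? length ys) (¬¬-map (unique-⊆-length u) (¬¬-all xs⊆ys))

-- The recursive call is on the predicate with the head `x` removed, which prevents repetitions.
-- Whether `x` satisfies `P` is decided under the double negation.
enumerate : {A : Set ℓ} {P : A → Set ℓ} (xs : List A) → (∀ x → x ∉ xs → ¬ P x) →
            ¬ ¬ ∃ λ ws → Unique ws × All P ws × (∀ x → P x → ¬ ¬ x ∈ ws)
enumerate []       ¬p k = k ([] , [] , [] , λ x px → contradiction px (¬p x λ ()))
enumerate {P = P} (x ∷ xs) ¬p k =
  enumerate {P = λ y → P y × y ≢ x} xs
    (λ { y y∉ (py , y≢x) → ¬p y (λ { (here y≡x) → y≢x y≡x ; (there y∈) → y∉ y∈ }) py })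
    λ (ws , u , ps , c) → ¬¬-excluded-middle λ where
      (yes px) → k (x ∷ ws , All.map (λ (_ , y≢x) → ≢-sym y≢x) ps ∷ u , px ∷ All.map proj₁ ps ,
        λ y py k′ → ¬¬-excluded-middle λ where
          (yes y≡x) → k′ (here y≡x)
          (no y≢x)  → c y (py , y≢x) (k′ ∘ there))
      (no ¬px) → k (ws , u , All.map proj₁ ps , λ y py → c y (py , λ { refl → ¬px py }))

distinct : InfiniteSet A → ∀ n → ∃ λ (xs : List A) → Unique xs × length xs ≡ n
distinct inf ℕ.zero    = [] , [] , refl
distinct inf (ℕ.suc n) =
  let (xs , u , eq) = distinct inf n
      (x , x∉) = inf xs
  in x ∷ xs , All.tabulate (λ { y∈ refl → x∉ y∈ }) ∷ u , cong ℕ.suc eq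

-- Field arithmetic and the polynomial y² + y.

module FieldArithmetic {L : Language ℓ} {M : Structure L} (F : IsField M) where
  open IsField F

  commutativeRing : CommutativeRing ℓ ℓ
  commutativeRing = record { isCommutativeRing = isCommutativeRing }

  open CommutativeRing commutativeRing public
    using (+-assoc; +-comm; +-identityˡ; +-identityʳ; -‿inverseˡ; -‿inverseʳ; *-assoc; *-comm;
           *-identityˡ; *-identityʳ; distribˡ; zeroˡ; zeroʳ; ring; commutativeSemiring)
  open import Algebra.Properties.Ring ring public
  open import Algebra.Solver.Ring.NaturalCoefficients.Default commutativeSemiring
  open ≡-Reasoning

  x+a-a : ∀ x a → x + a + - a ≡ x
  x+a-a x a = trans (+-assoc x a (- a)) (trans (cong (x +_) (-‿inverseʳ a)) (+-identityʳ x))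

  x-a+a : ∀ x a → x + - a + a ≡ x
  x-a+a x a = trans (+-assoc x (- a) a) (trans (cong (x +_) (-‿inverseˡ a)) (+-identityʳ x))

  cancel-inverse : ∀ {s r} x → s * r ≡ 1# → r * (s * x) ≡ x
  cancel-inverse {s} {r} x sr≡1 = begin
    r * (s * x) ≡⟨ solve 3 (λ r s x → r :* (s :* x) := (s :* r) :* x) refl r s x ⟩
    (s * r) * x ≡⟨ cong (_* x) sr≡1 ⟩
    1# * x      ≡⟨ *-identityˡ x ⟩
    x           ∎

  *-cancel-0 : ∀ {x y} → x ≢ 0# → x * y ≡ 0# → y ≡ 0#
  *-cancel-0 {x} {y} x≢0 xy≡0 = let (r , xr≡1) = inverse x x≢0 in
    trans (sym (cancel-inverse y xr≡1)) (trans (cong (r *_) xy≡0) (zeroʳ r))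

  -- Unlike y², which is injective in characteristic two, this polynomial has two distinct roots
  -- over almost all of its values in every characteristic.
  g : ∣ M ∣ → ∣ M ∣
  g y = y * y + y

  conj : ∣ M ∣ → ∣ M ∣
  conj y = - (1# + y)

  1+y≡-conj : ∀ y → 1# + y ≡ - conj y
  1+y≡-conj y = sym (-‿involutive (1# + y))

  g-conj : ∀ y → g (conj y) ≡ g y
  g-conj y = begin
    z * z + z        ≡⟨ solve 1 (λ z → z :* z :+ z := z :* (con 1 :+ z)) refl z ⟩
    z * (1# + z)     ≡⟨ cong (z *_) (+-inverseˡ-unique (1# + z) y 1+z+y≡0) ⟩
    z * - y          ≡⟨ -‿distribʳ-* z y ⟨
    - (z * y)        ≡⟨ cong -_ (*-comm z y) ⟩
    - (y * z)        ≡⟨ -‿distribʳ-* y z ⟩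
    y * - z          ≡⟨ cong (y *_) (1+y≡-conj y) ⟨
    y * (1# + y)     ≡⟨ solve 1 (λ y → y :* (con 1 :+ y) := y :* y :+ y) refl y ⟩
    y * y + y        ∎
    where
    z = conj y
    1+z+y≡0 : 1# + z + y ≡ 0#
    1+z+y≡0 = begin
      1# + z + y   ≡⟨ solve 2 (λ z y → con 1 :+ z :+ y := z :+ (con 1 :+ y)) refl z y ⟩
      z + (1# + y) ≡⟨ -‿inverseˡ (1# + y) ⟩
      0#           ∎

  -- With d = y - z, the difference g y - g z factors as d (y + z + 1), and d can be cancelled.
  g-fibre : ∀ {y z} → g y ≡ g z → y ≢ z → y ≡ conj z
  g-fibre {y} {z} gy≡gz y≢z = +-inverseˡ-unique y (1# + z) (begin
    y + (1# + z)     ≡⟨ cong (_+ (1# + z)) (x-a+a y z) ⟨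
    d + z + (1# + z) ≡⟨ *-cancel-0 d≢0 (+-identityʳ-unique (g z) _ dd) ⟩
    0#               ∎)
    where
    d = y + - z
    d≢0 : d ≢ 0#
    d≢0 d≡0 = y≢z (trans (sym (x-a+a y z)) (trans (cong (_+ z) d≡0) (+-identityˡ z)))
    dd : g z + d * (d + z + (1# + z)) ≡ g z
    dd = begin
      g z + d * (d + z + (1# + z)) ≡⟨ solve 2 (λ d z → (z :* z :+ z) :+ d :* (d :+ z :+ (con 1 :+ z))
                                        := (d :+ z) :* (d :+ z) :+ (d :+ z)) refl d z ⟩
      g (d + z)                    ≡⟨ cong g (x-a+a y z) ⟩
      g y                          ≡⟨ gy≡gz ⟩
      g z                          ∎

  most-g≢ : ∀ x → Most (λ y → g y ≢ x)
  most-g≢ x k = ¬¬-excluded-middle {A = ∃ λ z → g z ≡ x} λ where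
    (yes (z , gz≡x)) → k (z ∷ conj z ∷ [] , λ y y∉ gy≡x →
      y∉ (there (here (g-fibre (trans gy≡x (sym gz≡x)) (y∉ ∘ here)))))
    (no ¬z) → k ([] , λ y _ gy≡x → ¬z (y , gy≡x))

  ≡conj⇒2y+1≡0 : ∀ {y} → y ≡ conj y → (1# + 1#) * y + 1# ≡ 0#
  ≡conj⇒2y+1≡0 {y} y≡ = begin
    (1# + 1#) * y + 1# ≡⟨ solve 1 (λ y → (con 1 :+ con 1) :* y :+ con 1 := y :+ (con 1 :+ y)) refl y ⟩
    y + (1# + y)       ≡⟨ cong (_+ (1# + y)) y≡ ⟩
    conj y + (1# + y)  ≡⟨ -‿inverseˡ (1# + y) ⟩
    0#                 ∎

  -- A fixed point of `conj` solves 2y + 1 = 0, which has no solution in characteristic two and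
  -- exactly one otherwise.
  most-≢conj : Most (λ y → y ≢ conj y)
  most-≢conj k = ¬¬-excluded-middle {A = 1# + 1# ≡ 0#} λ where
    (yes 2≡0) → k ([] , λ y _ y≡ → 1≢0 (begin
      1#                 ≡⟨ +-identityˡ 1# ⟨
      0# + 1#            ≡⟨ cong (_+ 1#) (zeroˡ y) ⟨
      0# * y + 1#        ≡⟨ cong (λ t → t * y + 1#) 2≡0 ⟨
      (1# + 1#) * y + 1# ≡⟨ ≡conj⇒2y+1≡0 y≡ ⟩
      0#                 ∎))
    (no 2≢0) → let (r , 2r≡1) = inverse _ 2≢0 in
      k (r * - 1# ∷ [] , λ y y∉ y≡ → y∉ (here (begin
        y                     ≡⟨ cancel-inverse y 2r≡1 ⟨
        r * ((1# + 1#) * y)   ≡⟨ cong (r *_) (+-inverseˡ-unique _ 1# (≡conj⇒2y+1≡0 y≡)) ⟩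
        r * - 1#              ∎)))

  c-c²≢0 : ∀ {c} → c ≢ 0# → c ≢ 1# → c + - (c * c) ≢ 0#
  c-c²≢0 {c} c≢0 c≢1 c-c²≡0 = let (r , cr≡1) = inverse c c≢0 in c≢1 (begin
    c               ≡⟨ cancel-inverse c cr≡1 ⟨
    r * (c * c)     ≡⟨ cong (r *_) (sym (trans (+-inverseˡ-unique c _ c-c²≡0) (-‿involutive _))) ⟩
    r * c           ≡⟨ *-comm r c ⟩
    c * r           ≡⟨ cr≡1 ⟩
    1#              ∎)

  g-scale : ∀ c y → g (c * y) + - (c * c * g y) ≡ (c + - (c * c)) * y
  g-scale c y = begin
    -- A zero is inserted as `(c * c + q) * y`, so that what remains is a semiring identity with `q`
    -- as a variable.
    g (c * y) + - p                 ≡⟨ cong (_+ - p) (+-identityʳ (g (c * y))) ⟨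
    g (c * y) + 0# + - p            ≡⟨ cong (λ t → g (c * y) + t + - p) (zeroˡ y) ⟨
    g (c * y) + 0# * y + - p        ≡⟨ cong (λ t → g (c * y) + t * y + - p) (-‿inverseʳ (c * c)) ⟨
    g (c * y) + (c * c + q) * y + - p
      ≡⟨ cong (_+ - p) (solve 3 (λ c y q → (c :* y) :* (c :* y) :+ c :* y :+ (c :* c :+ q) :* y
           := (c :+ q) :* y :+ c :* c :* (y :* y :+ y)) refl c y q) ⟩
    (c + q) * y + p + - p           ≡⟨ x+a-a ((c + q) * y) p ⟩
    (c + q) * y                     ∎
    where
    q = - (c * c)
    p = c * c * g y

-- Definable weak orders and their classes.

record IsWeakOrder {L : Language ℓ} (M : Structure L) (φ : ParamFormula L ∣ M ∣ 2) : Set ℓ where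
  open NSemantics M φ
  field
    asym       : ∀ x y → x < y → ¬ y < x
    negTrans   : ∀ x y z → ¬ x < y → ¬ y < z → ¬ x < z
    -- What is kept of the infinite chains; it passes to the reverse order and survives changes at
    -- finitely many points.
    noAntichain : ∀ xs → ¬ (∀ x y → x ∉ xs → y ∉ xs → ¬ x < y)

module Ordered {L : Language ℓ} {M : Structure L} (F : IsMinimalField M)
               (φ : ParamFormula L ∣ M ∣ 2) (W : IsWeakOrder M φ) where
  open IsMinimalField F
  open IsMinimal isMinimal using (infinite)
  open IsField isField
  open FieldArithmetic isField
  open RingSymbols symbols
  open IsWeakOrder W
  open NSemantics M φ

  private
    K : Set ℓ
    K = ∣ M ∣

    variable
      u v w x y z : K

    _⊕_ _⊗_ : Term L n → Term L n → Term L n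
    s ⊕ t = func addˢ (s ∷ t ∷ [])
    s ⊗ t = func mulˢ (s ∷ t ∷ [])

    ⊝_ : Term L n → Term L n
    ⊝ t = func negˢ (t ∷ [])

    infixl 8 _⊕_
    infixl 9 _⊗_
    infix 10 ⊝_

  Low : K → Set ℓ
  Low x = ∃ λ xs → ∀ y → y ∉ xs → x < y

  infix 4 _∼_
  _∼_ : K → K → Set ℓ
  x ∼ y = ¬ x < y × ¬ y < x

  sim : Term L n → Term L n → NFormula L n
  sim s t = not (s ≺ t) ∧ not (t ≺ s)

  ∼-refl : x ∼ x
  ∼-refl = (λ x<x → asym _ _ x<x x<x) , (λ x<x → asym _ _ x<x x<x)

  ∼-sym : x ∼ y → y ∼ x
  ∼-sym (p , q) = q , p

  ∼-trans : x ∼ y → y ∼ z → x ∼ z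
  ∼-trans (p , q) (p′ , q′) = negTrans _ _ _ p p′ , negTrans _ _ _ q′ q

  -- By minimality a class is finite or cofinite, and a cofinite class would be a cofinite
  -- antichain.
  most-≁ : ∀ x → Most (λ y → ¬ y ∼ x)
  most-≁ x k with dichotomy isMinimal (sim (var 0F) (var 1F)) (x ∷ [])
  ... | inj₁ fin        = k fin
  ... | inj₂ (xs , cof) = noAntichain xs λ y z y∉ z∉ →
    negTrans y x z (proj₁ (cof y y∉)) (proj₂ (cof z z∉))

  most-class-∉ : ∀ xs → Most (λ y → ∀ x → x ∼ y → x ∉ xs)
  most-class-∉ xs = most-map (λ y h x x∼y x∈ → h x x∈ (∼-sym x∼y)) (most-∀∈ most-≁ xs)

  -- Definable involutions, translations and homotheties.

  module _ (θ : NFormula L 3) (a : K) where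
    private
      G : K → K → Set ℓ
      G x y = ⟦ θ ⟧ (y ∷ x ∷ a ∷ [])

    module _ (G-sym : ∀ {x y} → G x y → G y x)
             (G-functional : ∀ {x y z} → G x y → G x z → ¬ ¬ y ≡ z)
             (G-total : Most (λ x → ¬ ¬ ∃ λ y → G x y)) where

      private
        most-¬G : ∀ y → Most (λ x → ¬ G x y)
        most-¬G y k = ¬¬-excluded-middle {A = ∃ λ x → G x y} λ where
          (yes (z , Gzy)) → k (z ∷ [] , λ x x∉ Gxy →
            G-functional (G-sym Gxy) (G-sym Gzy) λ x≡z → x∉ (here x≡z))
          (no ¬Gy) → k ([] , λ x _ Gxy → ¬Gy (x , Gxy))

        -- Each y has at most one partner, so almost every x lies outside `zs` together with its
        -- image.
        pair : ∀ zs → ¬ (∀ x y → G x y → x ∉ zs → ¬ y ∉ zs)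
        pair zs h = most-∃ infinite (most-× G-total (most-× (most-∉ zs) (most-∀∈ most-¬G zs)))
          λ (x , Gx , x∉ , h′) → Gx λ (y , Gxy) → h x y Gxy x∉ λ y∈ → h′ y y∈ Gxy

      involution-∼ : Most (λ x → ∀ y → G x y → x ∼ y)
      involution-∼ k
        with dichotomy isMinimal (forall′ (θ ⊃ sim (var 1F) (var 0F))) (a ∷ [])
      ... | inj₂ cof = k cof
      ... | inj₁ (xs , ¬∼)
        with dichotomy isMinimal (forall′ (θ ⊃ (var 1F ≺ var 0F))) (a ∷ [])
      ...   | inj₂ (ys , <σ) = pair ys λ x y Gxy x∉ y∉ →
              asym x y (<σ x x∉ y Gxy) (<σ y y∉ x (G-sym Gxy))
      -- Neither x < σ x nor, by the same fact at σ x, σ x < x; so x ∼ σ x after all.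
      ...   | inj₁ (ys , ¬<σ) = pair (xs ++ ys) λ x y Gxy x∉ y∉ →
              ¬∼ x (x∉ ∘ ∈-++⁺ˡ) λ z Gxz →
                (λ x<z → ¬<σ x (x∉ ∘ ∈-++⁺ʳ xs) λ z′ Gxz′ x≮z′ →
                  G-functional Gxz Gxz′ λ { refl → x<z x≮z′ }) ,
                (λ z<x → ¬<σ y (y∉ ∘ ∈-++⁺ʳ xs) λ z′ Gyz′ y≮z′ →
                  G-functional (G-sym Gxy) Gyz′ λ { refl → G-functional Gxy Gxz λ { refl → z<x y≮z′ } })

  reflection-∼ : ∀ a → Most (λ x → ∀ y → x + y ≡ a → x ∼ y)
  reflection-∼ a = most-map (λ x h y eq → h y (λ k → k eq)) $
    involution-∼ ((var 1F ⊕ var 0F) ≈ var 2F) a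
      (λ {x} {y} → ¬¬-map (trans (+-comm y x)))
      (λ {x} p q k → p λ eq → q λ eq′ → k (+-cancelˡ x _ _ (trans eq (sym eq′))))
      (most-always λ x k → k (- x + a , λ k′ → k′ (trans (cong (x +_) (+-comm _ _))
        (trans (+-comm _ _) (x-a+a a x)))))

  inversion-∼ : ∀ a → a ≢ 0# → Most (λ x → ∀ y → x * y ≡ a → x ∼ y)
  inversion-∼ a a≢0 = most-map (λ x h y eq → h y (λ k → k eq)) $
    involution-∼ ((var 1F ⊗ var 0F) ≈ var 2F) a
      (λ {x} {y} → ¬¬-map (trans (*-comm y x)))
      (λ p q k → p λ eq → q λ eq′ → k (*-cancel eq eq′))
      (most-map (λ x x≢0 k → let (r , xr≡1) = inverse x x≢0 in
        k (r * a , λ k′ → k′ (cancel-inverse a (trans (*-comm r x) xr≡1)))) (most-≢ 0#))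
    where
    *-cancel : x * y ≡ a → x * z ≡ a → y ≡ z
    *-cancel {x} {y} {z} eq eq′ =
      let (r , xr≡1) = inverse x λ { refl → a≢0 (trans (sym eq) (zeroˡ y)) }
      in trans (sym (cancel-inverse y xr≡1)) (trans (cong (r *_) (trans eq (sym eq′))) (cancel-inverse z xr≡1))

  -- Both `x` and `x + a` are equivalent to `- x`, through the reflections with sums 0 and `a`.
  most-+-∼ : ∀ a → Most (λ x → x ∼ x + a)
  most-+-∼ a = most-map
    (λ x (p , q) → ∼-trans (p (- x) (-‿inverseʳ x))
      (∼-sym (q (- x) (trans (cong (_+ - x) (+-comm x a)) (x+a-a a x)))))
    (most-× (reflection-∼ 0#) (most-∘ (_+ a) (_+ - a) (λ x → x+a-a x a) (reflection-∼ a)))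

  -- Both `x` and `s * x` are equivalent to the inverse of `x`, through the inversions with products
  -- 1 and `s`.
  most-*-∼ : ∀ s → s ≢ 0# → Most (λ x → x ∼ s * x)
  most-*-∼ s s≢0 = let (r , sr≡1) = inverse s s≢0 in most-map
    (λ x (p , q , x≢0) → let (x⁻¹ , xx⁻¹≡1) = inverse x x≢0 in
      ∼-trans (p x⁻¹ xx⁻¹≡1)
        (∼-sym (q x⁻¹ (trans (*-assoc s x x⁻¹) (trans (cong (s *_) xx⁻¹≡1) (*-identityʳ s))))))
    (most-× (inversion-∼ 1# 1≢0) (most-× (most-∘ (s *_) (r *_) (λ x → cancel-inverse x sr≡1) (inversion-∼ s s≢0))
      (most-≢ 0#)))

  -- Stabilisers of classes.

  -- a stabilises the class of b under translation; both a and − a are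
  -- required so that H is a subgroup without an appeal to finiteness.
  H : K → K → Set ℓ
  H a b = ∀ x → x ∼ b → x + a ∼ b × x + - a ∼ b

  H′ : Fin n → Fin n → NFormula L n
  H′ i j = forall′ (sim (var 0F) (var (suc j)) ⊃
    (sim (var 0F ⊕ var (suc i)) (var (suc j)) ∧ sim (var 0F ⊕ ⊝ var (suc i)) (var (suc j))))

  H-neg : H u z → H (- u) z
  H-neg {u} h x x∼z = proj₂ (h x x∼z) , subst (λ t → x + t ∼ _) (sym (-‿involutive u)) (proj₁ (h x x∼z))

  H-add : H u z → H v z → H (u + v) z
  H-add {u} {z} {v} h k x x∼z =
    subst (_∼ z) (+-assoc x u v) (proj₁ (k _ (proj₁ (h x x∼z)))) ,
    subst (_∼ z) (trans (+-assoc x (- u) (- v)) (cong (x +_) (-‿+-comm u v))) (proj₂ (k _ (proj₂ (h x x∼z))))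

  -- An element `a` of the stabiliser puts `b + a` in the class of `b`, which is finite.
  H-finite : ∀ b → Most (λ a → ¬ H a b)
  H-finite b = most-map (λ a b+a≁b h → b+a≁b (proj₁ (h b ∼-refl)))
    (most-∘ (b +_) (_+ - b) (λ a → trans (cong (_+ - b) (+-comm b a)) (x+a-a a b)) (most-≁ b))

  -- f preserves every class that avoids the exceptional set.
  class-invariant : {f : K → K} → Most (λ x → x ∼ f x) → Most (λ b → ∀ x → x ∼ b → f x ∼ b)
  class-invariant m = most-join λ k → m λ (xs , h) →
    k (most-map (λ b avoid x x∼b → ∼-trans (∼-sym (h x (avoid x x∼b))) x∼b) (most-class-∉ xs))

  most-H : ∀ a → Most (H a)
  most-H a = most-map (λ b (p , q) x x∼b → p x x∼b , q x x∼b)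
    (most-× (class-invariant (most-+-∼ a)) (class-invariant (most-+-∼ (- a))))

  -- Translation by `s * a` is translation by `a` conjugated by the homothety `s`: x + s a = s (r x
  -- + a).
  H-* : ∀ {s r b} → s * r ≡ 1# → (∀ x → x ∼ b → s * x ∼ b) → (∀ x → x ∼ b → r * x ∼ b) →
        ∀ a → H a b → H (s * a) b
  H-* {s} {r} {b} sr≡1 s-inv r-inv a h x x∼b =
    subst (_∼ b) (trans (distribˡ s (r * x) a) (cong (_+ s * a) srx≡x)) (s-inv _ (proj₁ h′)) ,
    subst (_∼ b) (trans (distribˡ s (r * x) (- a)) (cong₂ _+_ srx≡x (sym (-‿distribʳ-* s a))))
      (s-inv _ (proj₂ h′))
    where
    h′ = h (r * x) (r-inv x x∼b)
    srx≡x = cancel-inverse x (trans (*-comm r s) sr≡1)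

  most-H-* : ∀ s → s ≢ 0# → Most (λ b → ∀ a → H a b → H (s * a) b)
  most-H-* s s≢0 =
    let (r , sr≡1) = inverse s s≢0
        r≢0 = λ r≡0 → 1≢0 (trans (sym sr≡1) (trans (cong (s *_) r≡0) (zeroʳ s)))
    in most-map (λ b (p , q) → H-* sr≡1 p q)
         (most-× (class-invariant (most-*-∼ s s≢0)) (class-invariant (most-*-∼ r r≢0)))

  -- The chain of finite subgroups.

  -- Comparison of the least classes stabilised by t and by u.
  infix 4 _≼_
  _≼_ : K → K → Set ℓ
  t ≼ u = ∀ b → H u b → ¬ (∀ c → H t c → b < c)

  ≼′ : Fin n → Fin n → NFormula L n
  ≼′ i j = forall′ (H′ (suc j) 0F ⊃ not (forall′ (H′ (suc (suc i)) 0F ⊃ (var 1F ≺ var 0F))))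

  ≼-total : ¬ u ≼ v → v ≼ u
  ≼-total u⋠v c Huc v≻c = u⋠v λ b Hvb u≻b → asym b c (u≻b c Huc) (v≻c b Hvb)

  ≼-refl : u ≼ u
  ≼-refl b Hub u≻b = asym b b (u≻b b Hub) (u≻b b Hub)

  ≼-trans : u ≼ v → v ≼ w → u ≼ w
  ≼-trans u≼v v≼w b Hwb u≻b = v≼w b Hwb λ c Hvc b≮c → u≼v c Hvc λ d Hud c≮d →
    negTrans b c d (λ b<c → b<c b≮c) (λ c<d → c<d c≮d) (u≻b d Hud)

  -- The intersection of the stabilisers of the classes of all `u` above `t`. It is a subgroup
  -- inside the finite `H _ t`, and it grows with `t` because fewer `u` remain.
  V : K → K → Set ℓ
  V x t = ∀ u → t ≼ u → H x u

  V′ : Fin n → Fin n → NFormula L n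
  V′ i j = forall′ (≼′ (suc j) 0F ⊃ H′ (suc i) 0F)

  V-stable : Stable (V x y)
  V-stable {x} {y} = stable (V′ 0F 1F) (x ∷ y ∷ [])

  V-mono : u ≼ v → V x u → V x v
  V-mono u≼v h w v≼w = h w (≼-trans u≼v v≼w)

  V-neg : V x z → V (- x) z
  V-neg h u z≼u = H-neg (h u z≼u)

  V-add : V x z → V y z → V (x + y) z
  V-add h k u z≼u = H-add (h u z≼u) (k u z≼u)

  V-finite : ∀ t → Most (λ x → ¬ V x t)
  V-finite t = most-map (λ x ¬h h → ¬h (h t ≼-refl)) (H-finite t)

  most-g : {P : K → Set ℓ} → Most P → Most (λ y → P (g y))
  most-g m = most-join λ k → m λ (xs , p) →
    k (most-map (λ y h → p (g y) λ gy∈ → h (g y) gy∈ refl) (most-∀∈ most-g≢ xs))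

  module _ (low-infinite : ∀ xs → ¬ ¬ ∃ λ x → x ∉ xs × Low x) where

    -- Since `u` stabilises almost all classes, it stabilises that of some low `b`. Only finitely
    -- many `y` are not above `b`, and almost every `t` stabilises none of their classes, so all
    -- classes that `t` stabilises lie above `b`.
    most-⋠ : ∀ u → Most (λ t → ¬ t ≼ u)
    most-⋠ u = most-join λ k → most-H u λ (xs , Hu) → low-infinite xs λ (b , b∉ , ys , b<) →
      k (most-map (λ t h t≼u → t≼u b (Hu b b∉) λ c Htc b≮c →
          b< c (λ c∈ → h c c∈ Htc) b≮c)
        (most-∀∈ H-finite ys))

    eventually : {P : K → Set ℓ} → Most P → Most (λ t → ∀ u → t ≼ u → P u)
    eventually m = most-join λ k → m λ (xs , p) →
      k (most-map (λ t h u t≼u → p u λ u∈ → h u u∈ t≼u) (most-∀∈ most-⋠ xs))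

    most-V : ∀ x → Most (V x)
    most-V x = eventually (most-H x)

    most-V-* : ∀ s → s ≢ 0# → Most (λ t → ∀ x → V x t → V (s * x) t)
    most-V-* s s≢0 = most-map (λ t h x Vxt u t≼u → h u t≼u x (Vxt u t≼u)) (eventually (most-H-* s s≢0))

    -- Roots of y² + y in the chain.

    -- x = y² + y for some y, not equal to the other root −1 − y, that lies
    -- in every V t containing x.
    rooted : NFormula L 1
    rooted = not (forall′ (not (
      (var 0F ⊗ var 0F ⊕ var 0F ≈ var 1F) ∧
      (not (var 0F ≈ ⊝ (func oneˢ [] ⊕ var 0F)) ∧
      forall′ (V′ 2F 0F ⊃ V′ 1F 0F)))))

    -- Let f be the length of `xs` and w the number of elements of `V t` outside `xs`. Two roots for
    -- each of these give 2w ≤ f + w, while `t` is chosen so that `V t` contains 2f + 1 distinct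
    -- elements, whence 2f < f + w.
    most-rooted-absurd : ∀ xs → ¬ (∀ x → x ∉ xs → ⟦ rooted ⟧ (x ∷ []))
    most-rooted-absurd xs root =
      most-∃ infinite (most-× (most-V 1#) (most-∀∈ most-V zs)) λ (t , V1t , Vzs) →
      V-finite t λ (ys , Vt-fin) →
      enumerate ys (λ x x∉ (Vxt , _) → Vt-fin x x∉ Vxt) λ (ws , uws , Vws , complete) →
      double t V1t ws uws Vws λ (ps , ups , Vps , 2w) →
      let covered : ∀ x → V x t → ¬ ¬ x ∈ xs ++ ws
          covered x Vxt k = ¬¬-excluded-middle λ where
            (yes x∈) → k (∈-++⁺ˡ x∈)
            (no x∉)  → complete x (Vxt , x∉) (k ∘ ∈-++⁺ʳ xs)
      in too-many (length xs) (length ws)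
        (subst₂ _≤_ 2w (length-++ xs) (unique-length-≤ ups λ {p} p∈ → covered p (proj₁ (All.lookup Vps p∈))))
        (subst₂ _≤_ lenzs (length-++ xs) (unique-length-≤ uzs λ {z} z∈ → covered z (Vzs z z∈)))
      where
      zs    = proj₁ (distinct infinite (ℕ.suc (length xs ℕ.+ length xs)))
      uzs   = proj₁ (proj₂ (distinct infinite (ℕ.suc (length xs ℕ.+ length xs))))
      lenzs = proj₂ (proj₂ (distinct infinite (ℕ.suc (length xs ℕ.+ length xs))))

      too-many : ∀ f w → w ℕ.+ w ≤ f ℕ.+ w → ¬ ℕ.suc (f ℕ.+ f) ≤ f ℕ.+ w
      too-many f w 2w≤f+w 2f<f+w = ℕ.<⇒≱ (ℕ.+-cancelˡ-< f f w 2f<f+w) (ℕ.+-cancelʳ-≤ w w f 2w≤f+w)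

      fresh : ∀ {t ws x p q} → All (x ≢_) ws → g p ≡ x → V q t × g q ∈ ws → p ≢ q
      fresh x∉ws gp≡x (_ , gq∈) refl = All.lookup x∉ws gq∈ (sym gp≡x)

      -- The second root -1 - y lies in `V t` because 1 and y do; roots over different values
      -- differ.
      double : ∀ t → V 1# t → ∀ ws → Unique ws → All (λ x → V x t × x ∉ xs) ws →
               ¬ ¬ ∃ λ ps → Unique ps × All (λ p → V p t × g p ∈ ws) ps × length ps ≡ length ws ℕ.+ length ws
      double t V1t []       []         []                   k = k ([] , [] , [] , refl)
      double t V1t (x ∷ ws) (x∉ws ∷ u) ((Vxt , x∉) ∷ Vws) k =
        double t V1t ws u Vws λ (ps , ups , Vps , eq) →
        root x x∉ λ y (gy≡x , y≢conj , Vy) → gy≡x λ { refl →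
          let Vyt = Vy t Vxt
          in k ( y ∷ conj y ∷ ps
               , ((λ y≡ → y≢conj (λ k → k y≡)) ∷ All.map (fresh x∉ws refl) Vps) ∷ All.map (fresh x∉ws (g-conj y)) Vps ∷ ups
               , (Vyt , here refl) ∷ (V-neg (V-add V1t Vyt) , here (g-conj y)) ∷
                 All.map (λ (Vpt , gp∈) → Vpt , there gp∈) Vps
               , cong ℕ.suc (trans (cong ℕ.suc eq) (sym (ℕ.+-suc (length ws) (length ws))))) }

    few-rooted-absurd : ∀ xs → ¬ (∀ x → x ∉ xs → ¬ ⟦ rooted ⟧ (x ∷ []))
    few-rooted-absurd xs ¬root =
      most-× (most-V-* c c≢0) (most-× (most-V-* (c * c) c²≢0) (most-V-* r r≢0)) λ (ts , closed) →
      -- For `t` in `ts` the group `V t` may fail to be closed under the three homotheties. These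
      -- groups are finite, so `g y` and `g (c * y)` can avoid them all.
      let Avoids : K → Set ℓ
          Avoids x = x ∉ xs × (∀ t → t ∈ ts → ¬ V x t)
          mq : Most (λ y → Avoids (g y) × y ≢ conj y)
          mq = most-× (most-g (most-× (most-∉ xs) (most-∀∈ V-finite ts))) most-≢conj
          -- Otherwise `y` itself would witness that `g y` is rooted.
          escape : ∀ y → Avoids (g y) × y ≢ conj y → ¬ (∀ t → V (g y) t → V y t)
          escape y ((gy∉ , _) , y≢conj) imp =
            ¬root (g y) gy∉ λ k → k y ((λ k′ → k′ refl) , (λ k′ → k′ y≢conj) , imp)
      in most-∃ infinite (most-× mq (most-∘ (c *_) (c⁻¹ *_) (λ x → cancel-inverse x cc⁻¹≡1) mq)) λ (y , q , q′) →
        escape y q λ t Vxt → V-stable λ ¬Vyt →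
        escape (c * y) q′ λ t′ Vx′t′ → V-stable λ ¬Vcyt′ →
        let t∉  = λ t∈ → proj₂ (proj₁ q) t t∈ Vxt
            t′∉ = λ t′∈ → proj₂ (proj₁ q′) t′ t′∈ Vx′t′
        -- The larger of the two groups contains both values, hence `y`, and by closure also
        -- `c * y`.
        in ¬¬-excluded-middle {A = t ≼ t′} λ where
          (yes t≼t′) → ¬Vcyt′ (proj₁ (closed t′ t′∉) y (solve-y (closed t′ t′∉) (V-mono t≼t′ Vxt) Vx′t′))
          (no t⋠t′)  → ¬Vyt (solve-y (closed t t∉) Vxt (V-mono (≼-total t⋠t′) Vx′t′))
      where
      -- Avoiding 0 and 1 makes c - c² invertible, with inverse `r`.
      c∉ = proj₂ (infinite (0# ∷ 1# ∷ []))
      c  = proj₁ (infinite (0# ∷ 1# ∷ []))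
      c≢0 : c ≢ 0#
      c≢0 c≡0 = c∉ (here c≡0)
      c⁻¹ = proj₁ (inverse c c≢0)
      cc⁻¹≡1 = proj₂ (inverse c c≢0)
      c²≢0 : c * c ≢ 0#
      c²≢0 c²≡0 = c≢0 (*-cancel-0 c≢0 c²≡0)
      d≢0 : c + - (c * c) ≢ 0#
      d≢0 = c-c²≢0 c≢0 λ c≡1 → c∉ (there (here c≡1))
      r = proj₁ (inverse _ d≢0)
      dr≡1 = proj₂ (inverse _ d≢0)
      r≢0 : r ≢ 0#
      r≢0 r≡0 = 1≢0 (trans (sym dr≡1) (trans (cong ((c + - (c * c)) *_) r≡0) (zeroʳ _)))

      Closed : K → Set ℓ
      Closed t = (∀ x → V x t → V (c * x) t) × (∀ x → V x t → V (c * c * x) t) × (∀ x → V x t → V (r * x) t)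

      solve-y : ∀ {t y} → Closed t → V (g y) t → V (g (c * y)) t → V y t
      solve-y {t} {y} (_ , c² , r·) Vgy Vgcy =
        subst (λ z → V z t) (trans (cong (r *_) (g-scale c y)) (cancel-inverse y dr≡1))
          (r· _ (V-add Vgcy (V-neg (c² _ Vgy))))

    low-infinite-absurd : ⊥
    low-infinite-absurd with dichotomy isMinimal rooted []
    ... | inj₁ (xs , ¬root) = few-rooted-absurd xs ¬root
    ... | inj₂ (xs , root)  = most-rooted-absurd xs root

-- Elimination of weak orders.

module _ {L : Language ℓ} {M : Structure L} (F : IsMinimalField M) where
  open IsMinimalField F
  open IsMinimal isMinimal using (infinite)
  open NSemantics M

  -- Every element is below almost all others or above almost all others, so the order or its
  -- reverse has infinitely many low elements.
  weakOrder-absurd : ∀ φ → ¬ IsWeakOrder M φ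
  weakOrder-absurd φ W =
    low-infinite-absurd F φ W λ xs k →
    low-infinite-absurd F φᵒ Wᵒ λ ys kᵒ →
    let (x , x∉) = infinite (xs ++ ys) in
    [ (λ low → k (x , x∉ ∘ ∈-++⁺ˡ , low))
        , (λ (zs , high) → kᵒ (x , x∉ ∘ ∈-++⁺ʳ xs , zs , λ y y∉ → to (rev x y) (high y y∉))) ]′ (low⊎high x)
    where
    open IsWeakOrder W
    open Ordered using (low-infinite-absurd)
    open Ordered F φ W using (Low; most-≁)

    φᵒ : ParamFormula L ∣ M ∣ 2
    φᵒ = definedRel φ (var 1F ≺ var 0F) []

    rev : ∀ x y → (_<_ φ y x) ⇔ (_<_ φᵒ x y)
    rev = definedRel⇔ φ (var 1F ≺ var 0F) []

    Wᵒ : IsWeakOrder M φᵒ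
    Wᵒ = record
      { asym        = λ x y x<y y<x → asym x y (from (rev y x) y<x) (from (rev x y) x<y)
      ; negTrans    = λ x y z x≮y y≮z x<z →
          negTrans z y x (y≮z ∘ to (rev y z)) (x≮y ∘ to (rev x y)) (from (rev x z) x<z)
      ; noAntichain = λ xs h → noAntichain xs λ x y x∉ y∉ → h y x y∉ x∉ ∘ to (rev y x)
      }

    low⊎high : ∀ x → Low x ⊎ ∃ λ xs → ∀ y → y ∉ xs → _<_ φ y x
    low⊎high x with dichotomy φ isMinimal (var 1F ≺ var 0F) (x ∷ [])
                  | dichotomy φ isMinimal (var 0F ≺ var 1F) (x ∷ [])
    ... | inj₂ low        | _               = inj₁ low
    ... | inj₁ _          | inj₂ high       = inj₂ high
    -- Almost all y would be incomparable to `x`, but its class is finite.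
    ... | inj₁ (xs , x≮y) | inj₁ (ys , y≮x) = ⊥-elim $ most-≁ x λ (zs , y≁x) →
      let (y , y∉) = infinite (xs ++ ys ++ zs) in
      y≁x y (y∉ ∘ ∈-++⁺ʳ xs ∘ ∈-++⁺ʳ ys) (y≮x y (y∉ ∘ ∈-++⁺ʳ xs ∘ ∈-++⁺ˡ) , x≮y y (y∉ ∘ ∈-++⁺ˡ))

  -- Induction on the exceptional points, each step changing the order at one of them.
  weakOrderOff-absurd : ∀ xs φ (let _<_ = _<_ φ) →
    (∀ x y → x < y → ¬ y < x) →
    (∀ x y z → x ∉ xs → y ∉ xs → z ∉ xs → ¬ x < y → ¬ y < z → ¬ x < z) →
    (∀ ys → ¬ (∀ x y → x ∉ ys → y ∉ ys → ¬ x < y)) → ⊥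
  weakOrderOff-absurd [] φ asym negTrans noAntichain = weakOrder-absurd φ (record
    { asym = asym
    ; negTrans = λ x y z → negTrans x y z (λ ()) (λ ()) (λ ())
    ; noAntichain = noAntichain
    })
  -- The exceptional point e is made the least element.
  weakOrderOff-absurd (e ∷ xs) φ asym negTrans noAntichain =
    weakOrderOff-absurd xs (definedRel φ θ (e ∷ []))
      (λ x y x<y y<x → let (y≢e , p) = from (θ⇔ x y) x<y
                           (x≢e , q) = from (θ⇔ y x) y<x
                       in asym x y (p x≢e) (q y≢e))
      -- Nothing is below `e`, so `z` is not `e`. Then `y` is not `e`, as `e` would be below `z`,
      -- and likewise `x` is not `e`, as `e` would be below `y`.
      (λ x y z x∉ y∉ z∉ x≮y y≮z x<z →
        let (z≢e , p) = from (θ⇔ x z) x<z in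
        y≮z (to (θ⇔ y z) (z≢e , λ y≢e → ⊥-elim (
        x≮y (to (θ⇔ x y) (y≢e , λ x≢e → ⊥-elim (
        x≢e λ x≢ → y≢e λ y≢ → z≢e λ z≢ →
        negTrans x y z (∉-∷ x≢ x∉) (∉-∷ y≢ y∉) (∉-∷ z≢ z∉)
          (λ x<y → x≮y (to (θ⇔ x y) (y≢e , λ _ → x<y)))
          (λ y<z → y≮z (to (θ⇔ y z) (z≢e , λ _ → y<z)))
          (p x≢e))))))))
      (λ ys h → noAntichain (e ∷ ys) λ x y x∉ y∉ x<y →
        h x y (x∉ ∘ there) (y∉ ∘ there) (to (θ⇔ x y) ((λ k → k (y∉ ∘ here)) , λ _ → x<y)))
    where
    θ : NFormula L 3
    θ = not (var 1F ≈ var 2F) ∧ (not (var 0F ≈ var 2F) ⊃ (var 0F ≺ var 1F))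

    θ⇔ = definedRel⇔ φ θ (e ∷ [])

    ∉-∷ : ∀ {x} → x ≢ e → x ∉ xs → x ∉ e ∷ xs
    ∉-∷ x≢e x∉ (here x≡e) = x≢e x≡e
    ∉-∷ x≢e x∉ (there x∈) = x∉ x∈

-- Compactness and the generic type.

module _ {L : Language ℓ} {A : Set ℓ} where

  substVars : (Fin k → Fin n) → ParamFormula L A k → ParamFormula L A n
  substVars {k = k} {n = n} σ ψ = rename ([ (λ i → σ i ↑ˡ arity) , n ↑ʳ_ ]′ ∘ splitAt k) formula [ params ]
    where open ParamFormula ψ

  Sat-substVars : (N : Structure L) (c : A → ∣ N ∣) (σ : Fin k → Fin n) (ψ : ParamFormula L A k) →
                  ∀ {v w} → (∀ i → lookup w (σ i) ≡ lookup v i) →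
                  Sat N c ψ v ⇔ Sat N c (substVars σ ψ) w
  Sat-substVars {k = k} N c σ ψ {v} {w} σ-agrees = ⊨-rename N agrees formula
    where
    open ParamFormula ψ
    ps = Vec.map c params
    agrees : Agrees N ([ (λ i → σ i ↑ˡ arity) , _ ↑ʳ_ ]′ ∘ splitAt k) (v Vec.++ ps) (w Vec.++ ps)
    agrees i rewrite lookup-splitAt k v ps i with splitAt k i
    ... | inj₁ j = trans (lookup-++ˡ w ps (σ j)) (σ-agrees j)
    ... | inj₂ j = lookup-++ʳ w ps j

theorem3 : {ℓ : Level} {L : Language ℓ} (M : Structure L) →
    IsMinimalField M →
    (p : GenericType M) (M̄ : MonsterModel M) →
    ¬ AlmostLinear M p M̄
theorem3 {L = L} M F p M̄ (φ , almostLinear) =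
  let (v , real) = saturated M-small embed Γ consistent in unrealised v real
  where
  open MonsterModel M̄
  open GenericType p using (type; nonAlgebraic)
  open IsAlmostLinearOrder almostLinear
  open IsStrictPartialOrder isStrictPartialOrder using (asym)
  open IsMinimalField F using (isMinimal)

  _<_ : ∣ M ∣ → ∣ M ∣ → Set _
  _<_ = DefinedRel M id φ

  pair : Fin 3 → Fin 3 → ParamFormula L ∣ M ∣ 3
  pair i j = substVars (lookup (i ∷ j ∷ [])) φ

  Sat-pair : (N : Structure L) (c : ∣ M ∣ → ∣ N ∣) → ∀ i j {w} →
             DefinedRel N c φ (lookup w i) (lookup w j) ⇔ Sat N c (pair i j) w
  Sat-pair N c i j = Sat-substVars N c (lookup (i ∷ j ∷ [])) φ λ { 0F → refl ; 1F → refl }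

  -- A realization consists of three generic elements with x ∼ y, y ∼ z and x < z, against the
  -- transitivity of ∼ on the generic type.
  data Γ : FormulaSet L ∣ M ∣ 3 where
    generic : ∀ i {ψ} → type ψ → Γ (substVars (λ _ → i) ψ)
    x≮y     : Γ (neg (pair 0F 1F))
    y≮x     : Γ (neg (pair 1F 0F))
    y≮z     : Γ (neg (pair 1F 2F))
    z≮y     : Γ (neg (pair 2F 1F))
    x<z     : Γ (pair 0F 2F)

  unrealised : ∀ v → ¬ Realizes model embed Γ v
  unrealised (x ∷ y ∷ z ∷ []) real =
    let point : ∀ i → Realization M p M̄
        point i = lookup (x ∷ y ∷ z ∷ []) i ,
          λ ψ ψ∈ → from (Sat-substVars model embed (λ _ → i) ψ λ { 0F → refl }) (real _ (generic i ψ∈))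
        <⇒ : ∀ i j → DefinedRel model embed φ (lookup (x ∷ y ∷ z ∷ []) i) (lookup (x ∷ y ∷ z ∷ []) j) →
             Sat model embed (pair i j) (x ∷ y ∷ z ∷ [])
        <⇒ i j = to (Sat-pair model embed i j)
    in IsEquivalence.trans ∼-isEquivalence {point 0F} {point 1F} {point 2F}
         (λ { (inj₁ x<y) → Poly.⊥-elim (real _ x≮y (<⇒ 0F 1F x<y))
            ; (inj₂ y<x) → Poly.⊥-elim (real _ y≮x (<⇒ 1F 0F y<x)) })
         (λ { (inj₁ y<z) → Poly.⊥-elim (real _ y≮z (<⇒ 1F 2F y<z))
            ; (inj₂ z<y) → Poly.⊥-elim (real _ z≮y (<⇒ 2F 1F z<y)) })
         (inj₁ (from (Sat-pair model embed 0F 2F) (real _ x<z)))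

  Intransitive : ∣ M ∣ → ∣ M ∣ → ∣ M ∣ → Set _
  Intransitive x y z = (¬ x < y × ¬ y < x) × (¬ y < z × ¬ z < y) × x < z

  ¬pair : ∀ {i j w} → ¬ lookup w i < lookup w j → Sat M id (neg (pair i j)) w
  ¬pair {i} {j} i≮j sat = contradiction (from (Sat-pair M id i j) sat) i≮j

  -- A formula of the generic type is not algebraic, hence cofinite, and its finitely many
  -- exceptions form `xs`.
  satisfy : ∀ {ψ} → Γ ψ → ∃ λ xs → ∀ x y z → x ∉ xs → y ∉ xs → z ∉ xs →
            Intransitive x y z → ¬ ¬ Sat M id ψ (x ∷ y ∷ z ∷ [])
  satisfy (generic i {ψ} ψ∈) with IsMinimal.minimal isMinimal ψ
  ... | inj₁ fin      = contradiction fin (nonAlgebraic ψ ψ∈)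
  ... | inj₂ (xs , c) = xs , λ x y z x∉ y∉ z∉ _ ¬sat →
    let ∉xs : ∀ i → lookup (x ∷ y ∷ z ∷ []) i ∉ xs
        ∉xs = λ { 0F → x∉ ; 1F → y∉ ; 2F → z∉ }
    in ∉xs i (c _ (¬sat ∘ to (Sat-substVars M id (λ _ → i) ψ λ { 0F → refl })))
  satisfy x≮y = [] , λ { x y z _ _ _ ((h , _) , _) k → k (¬pair h) }
  satisfy y≮x = [] , λ { x y z _ _ _ ((_ , h) , _) k → k (¬pair h) }
  satisfy y≮z = [] , λ { x y z _ _ _ (_ , (h , _) , _) k → k (¬pair h) }
  satisfy z≮y = [] , λ { x y z _ _ _ (_ , (_ , h) , _) k → k (¬pair h) }
  satisfy x<z = [] , λ { x y z _ _ _ (_ , _ , h) k → k (to (Sat-pair M id 0F 2F) h) }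

  satisfyAll : ∀ {Δ} → All Γ Δ → ∃ λ xs → ∀ x y z → x ∉ xs → y ∉ xs → z ∉ xs →
               Intransitive x y z → ¬ ¬ All (λ ψ → Sat M id ψ (x ∷ y ∷ z ∷ [])) Δ
  satisfyAll []       = [] , λ x y z _ _ _ _ k → k []
  satisfyAll (γ ∷ γs) =
    let (xs , h) = satisfy γ
        (ys , hs) = satisfyAll γs
    in xs ++ ys , λ x y z x∉ y∉ z∉ int k →
      h x y z (x∉ ∘ ∈-++⁺ˡ) (y∉ ∘ ∈-++⁺ˡ) (z∉ ∘ ∈-++⁺ˡ) int λ sat →
      hs x y z (x∉ ∘ ∈-++⁺ʳ xs) (y∉ ∘ ∈-++⁺ʳ xs) (z∉ ∘ ∈-++⁺ʳ xs) int λ sats → k (sat ∷ sats)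

  Sat-embed : ∀ {n} (ψ : ParamFormula L ∣ M ∣ n) v → Sat M id ψ v → Sat model embed ψ (Vec.map embed v)
  Sat-embed (ψ [ a ]) v sat = subst (λ w → _⊨_ model w ψ)
    (trans (map-++ embed v (Vec.map id a)) (cong (λ b → Vec.map embed v Vec.++ Vec.map embed b) (map-id a)))
    (to (elementary ψ _) sat)

  -- If a finite part of `Γ` were unsatisfiable, no intransitive triple could lie off the finite set
  -- `xs`, so < would be a weak order off `xs`.
  consistent : Consistent model embed Γ
  consistent Δ γs ¬sat =
    let (xs , h) = satisfyAll γs in
    weakOrderOff-absurd F xs φ
      (λ x y x<y y<x → x<y λ x<y → y<x (asym x<y))
      (λ x y z x∉ y∉ z∉ x≮y y≮z x<z → x<z λ x<z →
        let ¬¬< = λ {x} {y} (x<y : x < y) (k : ¬ x < y) → k x<y in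
        h x y z x∉ y∉ z∉
          -- By transitivity, y < x would give y < z and z < y would give x < y, so both
          -- incomparabilities hold.
          ( ((x≮y ∘ ¬¬<) , λ y<x → y≮z (¬¬< (<-trans y<x x<z)))
          , ((y≮z ∘ ¬¬<) , λ z<y → x≮y (¬¬< (<-trans x<z z<y)))
          , x<z )
          λ sats → ¬sat _ (All.map (λ {ψ} → Sat-embed ψ (x ∷ y ∷ z ∷ [])) sats))
      (λ ys h →
        -- The infinite chain has two distinct points off `ys`, and these are comparable.
        let (C , chain , inf) = infiniteChain
            (x , Cx , x∉) = inf ys
            (y , Cy , y∉) = inf (x ∷ ys)
        in [ (λ x≡y → y∉ (here (sym x≡y)))
               , [ (λ x<y → h x y x∉ (y∉ ∘ there) λ k → k x<y)
                     , (λ y<x → h y x (y∉ ∘ there) x∉ λ k → k y<x) ]′ ]′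
             (chain x y Cx Cy))
    where open IsStrictPartialOrder isStrictPartialOrder using () renaming (trans to <-trans)
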